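{- Let $\alpha=(a_1,\ldots,a_n)\in PP_n$ and let $k\ge 1$ be an integer. The following are equivalent: (i) for every maximal interval $[p,q]\subseteq U_\alpha$, $|[p,q]|\le k$ (where $|[p,q]|=q-p+1$); (ii) for all permutations $\sigma$ of $\{1,\ldots,n\}$, the $n$-tuple $\sigma(\alpha)=(a_{\sigma(1)},a_{\sigma(2)},\ldots,a_{\sigma(n)})$ is a $k$-Naples parking function of length $n$ (in particular, $\alpha\in PF_{n,k}$).
   Context: For integers $a\le b$, $[a,b]=\{a,\ldots,b\}$ and $[n]=[1,n]$. A parking preference of length $n$ is a tuple $\alpha=(a_1,\ldots,a_n)$ with entries in $[n]$; $PP_n$ is the set of these. Cars $c_1,\ldots,c_n$ arrive in this order at a one-way street with spots $1,\ldots,n$, and $a_i$ is the preferred spot of $c_i$. $k$-Naples parking rule: car $c_i$ parks in spot $a_i$ if it is free; otherwise it checks one at a time the spots $a_i-1,a_i-2,\ldots,a_i-k$ (only those that are $\ge 1$), parking in the first free one found; if none is free, it proceeds forward and parks in the first free spot $>a_i$, if any; otherwise it fails to park. $PF_{n,k}$, the set of $k$-Naples parking functions of length $n$, is the set of $\alpha\in PP_n$ for which all cars park under this rule. $|\alpha|_i$ is the number of indices $h$ with $a_h=i$. The excess function is $u_\alpha(j)=\sum_{i=j}^n|\alpha|_i-(n-j+1)$ for $j\in[n]$, and $U_\alpha=\{j\in[n] : u_\alpha(j)\ge 1\}$. A maximal interval $[p,q]\subseteq U_\alpha$ is a nonempty interval of consecutive integers contained in $U_\alpha$ that is maximal under inclusion.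 -}

module Defs where

open import Data.Fin using (Fin; toℕ; _≤_; _<_; _≤?_; _<?_; _≟_)
open import Data.Fin.Permutation using (Permutation′; _⟨$⟩ʳ_)
open import Data.Fin.Subset using (Subset; ⊥; ⁅_⁆; _∪_)
open import Data.Fin.Subset.Properties using (_∈?_)
open import Data.Integer using (ℤ; +_; 1ℤ) renaming (_+_ to _+ℤ_; _-_ to _-ℤ_; _≤_ to _≤ℤ_)
open import Data.List using (List; []; _∷_; _++_; length; map; filter; find; reverse; allFin)
open import Data.Maybe using (Maybe; just)
open import Data.Nat as ℕ using (ℕ; suc; _+_; _∸_)
open import Data.Nat.ListAction using (sum)
open import Data.Product using (_×_)
open import Data.Vec.Functional using (Vector; rearrange; toList)
open import Level using (0ℓ)
open import Relation.Binary.PropositionalEquality using (_≡_)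
open import Relation.Nullary.Decidable using (¬?; _×-dec_)
open import Relation.Unary using (Pred; _⊆_)

private
  variable
    n : ℕ

-- The spots 1, …, n are the elements of Fin n: i stands for the spot numbered
-- suc (toℕ i).  Cars are likewise indexed by Fin n, in order of arrival.
spotNumber : Fin n → ℕ
spotNumber i = suc (toℕ i)

PP : ℕ → Set
PP n = Vector (Fin n) n

-- σ(α) = (a_{σ(1)}, …, a_{σ(n)})
permute : Permutation′ n → PP n → PP n
permute σ α = rearrange (σ ⟨$⟩ʳ_) α

-- The spots a − 1, a − 2, …, a − k that exist, in this (decreasing) order.
backward : ℕ → Fin n → List (Fin n)
backward {n} k a =
  filter (λ i → (i <? a) ×-dec (toℕ a ℕ.≤? toℕ i + k)) (reverse (allFin n))

-- The spots a + 1, …, n in increasing order.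
forward : Fin n → List (Fin n)
forward {n} a = filter (a <?_) (allFin n)

-- Where a car preferring spot a parks if the set of occupied spots is occ;
-- nothing if it fails to park.
parkingSpot : ℕ → Subset n → Fin n → Maybe (Fin n)
parkingSpot k occ a =
  find (λ i → ¬? (i ∈? occ)) (a ∷ backward k a ++ forward a)

-- AllPark k occ as: cars with preferences as, arriving in this order when the
-- set of occupied spots is occ, all park.
data AllPark (k : ℕ) {n : ℕ} : Subset n → List (Fin n) → Set where
  []  : ∀ {occ} → AllPark k occ []
  _∷_ : ∀ {occ a as s} →
        parkingSpot k occ a ≡ just s →
        AllPark k (occ ∪ ⁅ s ⁆) as →
        AllPark k occ (a ∷ as)

PF : (n k : ℕ) → Pred (PP n) 0ℓ
PF n k α = AllPark k ⊥ (toList α)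

-- |α|_i
multiplicity : PP n → Fin n → ℕ
multiplicity {n} α i = length (filter (λ h → α h ≟ i) (allFin n))

-- u_α(j)
excess : PP n → Fin n → ℤ
excess {n} α j =
  + sum (map (multiplicity α) (filter (j ≤?_) (allFin n)))
    -ℤ (+ n -ℤ + spotNumber j +ℤ 1ℤ)

U : PP n → Pred (Fin n) 0ℓ
U α j = 1ℤ ≤ℤ excess α j

⟦_,_⟧ : Fin n → Fin n → Pred (Fin n) 0ℓ
⟦ p , q ⟧ i = p ≤ i × i ≤ q

record IsMaximalInterval (S : Pred (Fin n) 0ℓ) (p q : Fin n) : Set where
  field
    nonempty  : p ≤ q
    contained : ⟦ p , q ⟧ ⊆ S
    maximal   : ∀ p′ q′ → ⟦ p′ , q′ ⟧ ⊆ S →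
                ⟦ p , q ⟧ ⊆ ⟦ p′ , q′ ⟧ → ⟦ p′ , q′ ⟧ ⊆ ⟦ p , q ⟧

-- |[p,q]| = q − p + 1, meaningful for p ≤ q.
intervalSize : Fin n → Fin n → ℕ
intervalSize p q = spotNumber q ∸ spotNumber p + 1

-- Suppose that a car fails to park and let f be the last free spot at that
-- time.  While f is free, a car preferring a spot in [f + 1, f + k] never drives
-- forward, and a car preferring a spot ≤ f never parks beyond f.  So for every
-- m ∈ [f + 1, f + k + 1] the spots [m, n] were filled by cars preferring spots
-- ≥ m, as does the failing car: [f + 1, f + k + 1] ⊆ U.
--
-- Conversely, let [p, q] be a maximal interval with more than k elements.  Then
-- u(p) = 1, i.e. n − p + 2 cars prefer spots ≥ p.  If these arrive first, in
-- increasing order, none of them parks below p: [p, p + k] ⊆ U bounds the number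
-- of cars preferring spots in [p, j] by j − p + 1 for j < p + k, so a car
-- preferring j < p + k finds a free spot in [p, j], and a car preferring
-- j ≥ p + k does not back up below p.  But there are only n − p + 1 spots ≥ p.
module Submission where

open import Defs
open import Data.Nat using (ℕ; _≤_)
open import Data.Fin using (Fin)
open import Data.Fin.Permutation using (Permutation′)
open import Function.Bundles using (_⇔_)

import Algebra.Properties.CommutativeMonoid.Sum as MonoidSum
open import Data.Bool using (true; false)
open import Data.Fin as Fin using (zero; suc; toℕ; fromℕ<; cast)
open import Data.Fin.Permutation using (cast-id; _∘ₚ_; _⟨$⟩ʳ_)
import Data.Fin.Properties as Fin
open import Data.Fin.Subset using (Subset; _∈_; _∉_; _∪_; ⁅_⁆; ⊥; ∣_∣; inside; outside)
open import Data.Fin.Subset.Properties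
  using (_∈?_; ∉⊥; x∈p∪q⁺; x∈p∪q⁻; x∈⁅y⁆⇒x≡y; ∣⊥∣≡0; ∣p∣≤n; ∣p∣≤∣x∷p∣; drop-there; ∪-identityʳ)
open import Data.Integer as ℤ using (1ℤ)
import Data.Integer.Properties as ℤ
import Data.Integer.Tactic.RingSolver as ℤ
open import Data.List
  using (List; []; _∷_; [_]; _++_; length; map; filter; find; lookup; reverse; allFin; tabulate)
import Data.List.Membership.Propositional as List
open import Data.List.Membership.Propositional.Properties
  using (∈-filter⁺; ∈-filter⁻; ∈-allFin; ∈-++⁺ˡ; ∈-++⁺ʳ)
open import Data.List.Properties
  using ( unfold-reverse; length-filter; filter-accept; filter-reject; filter-none; map-cong-local
        ; map-tabulate; tabulate-cong; tabulate-lookup; length-tabulate; lookup-tabulate)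
open import Data.List.Relation.Binary.Permutation.Propositional
  using (_↭_; prep; ↭-refl; ↭-sym; ↭-trans; ↭-reflexive; ↭⇒↭ₛ)
open import Data.List.Relation.Binary.Permutation.Propositional.Properties
  using (↭-length; filter-↭; shift; ++⁺ʳ; All-resp-↭; ++-commutativeMonoid)
open import Data.List.Relation.Binary.Permutation.Homogeneous using (onIndices)
open import Data.List.Relation.Binary.Permutation.Setoid.Properties using (onIndices-lookup)
open import Data.List.Relation.Unary.All as All using (All; []; _∷_)
import Data.List.Relation.Unary.All.Properties as All
open import Data.List.Relation.Unary.AllPairs using (AllPairs; []; _∷_)
import Data.List.Relation.Unary.AllPairs.Properties as AllPairs
open import Data.List.Relation.Unary.Any using (Any; here; there)
import Data.List.Relation.Unary.Any.Properties as Any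
open import Data.List.Relation.Unary.Linked.Properties using (Linked⇒AllPairs)
open import Data.List.Relation.Unary.Unique.Propositional using (Unique)
import Data.List.Relation.Unary.Unique.Propositional.Properties as Unique
import Data.List.Sort
open import Data.Maybe using (just; nothing)
open import Data.Maybe.Properties using (just-injective)
open import Data.Nat using (zero; suc; _+_; _∸_; _<_; _≤?_; _<?_; z≤n; s≤s; s≤s⁻¹)
open import Data.Nat.ListAction using (sum)
open import Data.Nat.Properties
open import Data.Product using (∃-syntax; _×_; _,_; proj₁; proj₂)
open import Data.Sum using (_⊎_; inj₁; inj₂)
open import Data.Vec using ([]; _∷_; here; there)
open import Data.Vec.Functional using (toList)
open import Function using (_∘_; id)
open import Function.Bundles using (mk⇔; Equivalence)
open import Level using (0ℓ)
open import Relation.Binary using (Rel; tri<; tri≈; tri>)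
open import Relation.Binary.PropositionalEquality hiding ([_])
open import Relation.Nullary using (¬_; yes; no; contradiction; does)
open import Relation.Nullary.Decidable using (¬?; _×-dec_; decidable-stable)
open import Relation.Unary using (Pred; Decidable; _⊆_)

private
  variable
    A B : Set
    n : ℕ

-- The order in which spots are tried

AllPairs-reverse⁺ : {R : Rel A 0ℓ} {xs : List A} →
                    AllPairs R xs → AllPairs (λ x y → R y x) (reverse xs)
AllPairs-reverse⁺ [] = []
AllPairs-reverse⁺ {R = R} {x ∷ xs} (x~xs ∷ xs~) =
  subst (AllPairs (λ x y → R y x)) (sym (unfold-reverse x xs))
    (AllPairs.++⁺ (AllPairs-reverse⁺ xs~) ([] ∷ [])
      (All.tabulate (λ y∈ → All.lookup x~xs (Any.reverse⁻ y∈) ∷ [])))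

AllPairs-map-local : {P : Pred A 0ℓ} {R S : Rel A 0ℓ} {xs : List A} →
                     (∀ {x y} → P x → P y → R x y → S x y) →
                     All P xs → AllPairs R xs → AllPairs S xs
AllPairs-map-local f []         []           = []
AllPairs-map-local f (px ∷ pxs) (x~xs ∷ xs~) =
  All.zipWith (λ (py , x~y) → f px py x~y) (pxs , x~xs) ∷ AllPairs-map-local f pxs xs~

module _ {P : Pred A 0ℓ} (P? : Decidable P) where

  find-just : ∀ {xs x} → find P? xs ≡ just x → P x
  find-just {y ∷ ys} eq with P? y
  ... | yes py = subst P (just-injective eq) py
  ... | no  _  = find-just {ys} eq

  find-All : ∀ {Q : Pred A 0ℓ} {xs x} → All Q xs → find P? xs ≡ just x → Q x
  find-All {xs = y ∷ _} (qy ∷ qys) eq with P? y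
  find-All (qy ∷ qys) refl | yes _ = qy
  find-All (qy ∷ qys) eq   | no  _ = find-All qys eq

  find-nothing : ∀ {xs} → find P? xs ≡ nothing → All (¬_ ∘ P) xs
  find-nothing {[]}     eq = []
  find-nothing {y ∷ ys} eq with P? y
  ... | no ¬py = ¬py ∷ find-nothing eq

  -- The search skips nothing that satisfies `P`, so its result stands no later in the list than
  -- `y`; sortedness turns this into `R`.
  find-first : ∀ {R : Rel A 0ℓ} {xs x} → AllPairs R xs → find P? xs ≡ just x →
               ∀ {y} → y List.∈ xs → P y → x ≡ y ⊎ R x y
  find-first {xs = z ∷ zs} (z~zs ∷ zs~) eq y∈ py with P? z
  find-first (z~zs ∷ zs~) refl (here refl) py | yes _ = inj₁ refl
  find-first (z~zs ∷ zs~) refl (there y∈)  py | yes _ = inj₂ (All.lookup z~zs y∈)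
  find-first (z~zs ∷ zs~) eq   (here refl) py | no ¬pz = contradiction py ¬pz
  find-first (z~zs ∷ zs~) eq   (there y∈)  py | no _   = find-first zs~ eq y∈ py

-- Before a i j : a car preferring a tries spot i before spot j.
Before : Fin n → Rel (Fin n) 0ℓ
Before a i j = (j Fin.< i × i Fin.≤ a) ⊎ (i Fin.< j × a Fin.< j)

module _ (k : ℕ) (a : Fin n) where

  private
    Backward? = λ (i : Fin n) → (i Fin.<? a) ×-dec (toℕ a ≤? toℕ i + k)

    candidates : List (Fin n)
    candidates = a ∷ backward k a ++ forward a

    allFin-< : AllPairs Fin._<_ (allFin n)
    allFin-< = AllPairs.tabulate⁺-< id

    -- One inequality covers all three segments of the list: spots from `a` onwards satisfy it
    -- trivially. `candidates-≥` is the converse.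
    ∈-candidates : ∀ {i} → toℕ a ≤ toℕ i + k → i List.∈ candidates
    ∈-candidates {i} a≤i+k with Fin.<-cmp i a
    ... | tri< i<a _ _ = there (∈-++⁺ˡ (∈-filter⁺ Backward? (Any.reverse⁺ (∈-allFin i)) (i<a , a≤i+k)))
    ... | tri≈ _ i≡a _ = here i≡a
    ... | tri> _ _ a<i = there (∈-++⁺ʳ (backward k a) (∈-filter⁺ (a Fin.<?_) (∈-allFin i) a<i))

    all-backward : All (λ i → i Fin.< a × toℕ a ≤ toℕ i + k) (backward k a)
    all-backward = All.all-filter Backward? (reverse (allFin n))

    all-forward : All (a Fin.<_) (forward a)
    all-forward = All.all-filter (a Fin.<?_) (allFin n)

    candidates-Before : AllPairs (Before a) candidates
    candidates-Before =
      All.++⁺ (All.map (λ (i<a , _) → inj₁ (i<a , ≤-refl)) all-backward)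
              (All.map (λ a<i → inj₂ (a<i , a<i)) all-forward)
      ∷ AllPairs.++⁺
          (AllPairs-map-local (λ (i<a , _) _ j<i → inj₁ (j<i , <⇒≤ i<a)) all-backward
            (AllPairs.filter⁺ Backward? (AllPairs-reverse⁺ allFin-<)))
          (AllPairs-map-local (λ _ a<j i<j → inj₂ (i<j , a<j)) all-forward
            (AllPairs.filter⁺ (a Fin.<?_) allFin-<))
          (All.map (λ (i<a , _) → All.map (λ a<j → inj₂ (<-trans i<a a<j , a<j)) all-forward) all-backward)

    candidates-≥ : All (λ i → toℕ a ≤ toℕ i + k) candidates
    candidates-≥ =
      m≤m+n _ k ∷ All.++⁺ (All.map proj₂ all-backward)
                    (All.map (λ a<i → ≤-trans (<⇒≤ a<i) (m≤m+n _ k)) all-forward)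

  module _ {occ : Subset n} where

    parkingSpot-free : ∀ {s} → parkingSpot k occ a ≡ just s → s ∉ occ
    parkingSpot-free = find-just (λ i → ¬? (i ∈? occ)) {candidates}

    parkingSpot-≥ : ∀ {s} → parkingSpot k occ a ≡ just s → toℕ a ≤ toℕ s + k
    parkingSpot-≥ = find-All (λ i → ¬? (i ∈? occ)) candidates-≥

    parkingSpot-first : ∀ {s i} → parkingSpot k occ a ≡ just s →
                        i ∉ occ → toℕ a ≤ toℕ i + k → s ≡ i ⊎ Before a s i
    parkingSpot-first eq i∉occ a≤i+k =
      find-first (λ i → ¬? (i ∈? occ)) candidates-Before eq (∈-candidates a≤i+k) i∉occ

    parkingSpot-nothing : ∀ {i} → parkingSpot k occ a ≡ nothing →
                          toℕ a ≤ toℕ i + k → i ∈ occ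
    parkingSpot-nothing {i} eq a≤i+k =
      decidable-stable (i ∈? occ)
        (All.lookup (find-nothing (λ i → ¬? (i ∈? occ)) eq) (∈-candidates a≤i+k))

-- Counting occupied spots and preferences

∣_∣≥_ : Subset n → ℕ → ℕ
∣ p     ∣≥ zero  = ∣ p ∣
∣ []    ∣≥ suc m = 0
∣ _ ∷ p ∣≥ suc m = ∣ p ∣≥ m

∣∪⁅_⁆∣ : ∀ {p : Subset n} s → s ∉ p → ∣ p ∪ ⁅ s ⁆ ∣ ≡ suc ∣ p ∣
∣∪⁅_⁆∣ {p = outside ∷ p} zero    s∉p = cong (suc ∘ ∣_∣) (∪-identityʳ p)
∣∪⁅_⁆∣ {p = inside  ∷ p} zero    s∉p = contradiction here s∉p
∣∪⁅_⁆∣ {p = outside ∷ p} (suc s) s∉p = ∣∪⁅ s ⁆∣ (s∉p ∘ there)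
∣∪⁅_⁆∣ {p = inside  ∷ p} (suc s) s∉p = cong suc (∣∪⁅ s ⁆∣ (s∉p ∘ there))

∣∪⁅_⁆∣≥-≤ : ∀ {p : Subset n} s m → s ∉ p → ∣ p ∪ ⁅ s ⁆ ∣≥ m ≤ suc (∣ p ∣≥ m)
∣∪⁅ s ⁆∣≥-≤                  zero    s∉p = ≤-reflexive (∣∪⁅ s ⁆∣ s∉p)
∣∪⁅_⁆∣≥-≤ {p = _ ∷ p} zero    (suc m) s∉p = m≤n⇒m≤1+n (≤-reflexive (cong (∣_∣≥ m) (∪-identityʳ p)))
∣∪⁅_⁆∣≥-≤ {p = _ ∷ p} (suc s) (suc m) s∉p = ∣∪⁅ s ⁆∣≥-≤ m (s∉p ∘ there)

∣∪⁅_⁆∣≥-> : ∀ {p : Subset n} s m → toℕ s < m → ∣ p ∪ ⁅ s ⁆ ∣≥ m ≡ ∣ p ∣≥ m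
∣∪⁅_⁆∣≥-> {p = _ ∷ p} zero    (suc m) s<m = cong (∣_∣≥ m) (∪-identityʳ p)
∣∪⁅_⁆∣≥-> {p = _ ∷ p} (suc s) (suc m) s<m = ∣∪⁅ s ⁆∣≥-> m (s≤s⁻¹ s<m)

∣⊥∣≥ : ∀ n m → ∣ ⊥ {n} ∣≥ m ≡ 0
∣⊥∣≥ n       zero    = ∣⊥∣≡0 n
∣⊥∣≥ zero    (suc m) = refl
∣⊥∣≥ (suc n) (suc m) = ∣⊥∣≥ n m

-- The additive form also covers thresholds `m` beyond `n`.
full-∣∣≥ : ∀ (p : Subset n) m → (∀ i → m ≤ toℕ i → i ∈ p) → n ≤ m + ∣ p ∣≥ m
full-∣∣≥ []            m       full = z≤n
full-∣∣≥ (outside ∷ p) zero    full with () ← full zero z≤n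
full-∣∣≥ (inside  ∷ p) zero    full = s≤s (full-∣∣≥ p 0 (λ i _ → drop-there (full (suc i) z≤n)))
full-∣∣≥ (_       ∷ p) (suc m) full = s≤s (full-∣∣≥ p m (λ i → drop-there ∘ full (suc i) ∘ s≤s))

∣∣-bounded : ∀ (p : Subset n) m → m ≤ n → (∀ {i} → i ∈ p → m ≤ toℕ i) → m + ∣ p ∣ ≤ n
∣∣-bounded p             zero    _         m≤ = ∣p∣≤n p
∣∣-bounded (inside  ∷ p) (suc m) _         m≤ with () ← m≤ here
∣∣-bounded (outside ∷ p) (suc m) (s≤s m≤n) m≤ = s≤s (∣∣-bounded p m m≤n (s≤s⁻¹ ∘ m≤ ∘ there))

-- If `l ≤ a`, the interval contributes a - l + 1 elements to `p`; if `a < l`, the bound is trivial.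
interval-∣∣ : ∀ (p : Subset n) l (a : Fin n) → (∀ i → l ≤ toℕ i → i Fin.≤ a → i ∈ p) → toℕ a < l + ∣ p ∣
interval-∣∣ (outside ∷ p) zero    a       h with () ← h zero z≤n z≤n
interval-∣∣ (inside  ∷ p) zero    zero    h = s≤s z≤n
interval-∣∣ (inside  ∷ p) zero    (suc a) h =
  s≤s (interval-∣∣ p 0 a (λ i _ → drop-there ∘ h (suc i) z≤n ∘ s≤s))
interval-∣∣ (x       ∷ p) (suc l) zero    h = s≤s z≤n
interval-∣∣ (x       ∷ p) (suc l) (suc a) h =
  s≤s (≤-trans (interval-∣∣ p l a (λ i l≤i → drop-there ∘ h (suc i) (s≤s l≤i) ∘ s≤s))
               (+-monoʳ-≤ l (∣p∣≤∣x∷p∣ x p)))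

lastFree : ∀ (p : Subset n) → (∀ i → i ∈ p) ⊎ ∃[ f ] f ∉ p × (∀ i → f Fin.< i → i ∈ p)
lastFree [] = inj₁ λ ()
lastFree (x ∷ p) with lastFree p
... | inj₂ (f , f∉p , all∈) =
  inj₂ (suc f , f∉p ∘ drop-there , λ { (suc i) f<i → there (all∈ i (s≤s⁻¹ f<i)) })
lastFree (outside ∷ p) | inj₁ all∈ = inj₂ (zero , (λ ()) , λ { (suc i) _ → there (all∈ i) })
lastFree (inside  ∷ p) | inj₁ all∈ = inj₁ λ { zero → here ; (suc i) → there (all∈ i) }

atLeast : ℕ → List (Fin n) → ℕ
atLeast m as = length (filter (λ a → m ≤? toℕ a) as)

atLeast-accept : ∀ {m} {a : Fin n} as → m ≤ toℕ a → atLeast m (a ∷ as) ≡ suc (atLeast m as)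
atLeast-accept {m = m} as m≤a = cong length (filter-accept (λ a → m ≤? toℕ a) {xs = as} m≤a)

atLeast-reject : ∀ {m} {a : Fin n} as → toℕ a < m → atLeast m (a ∷ as) ≡ atLeast m as
atLeast-reject {m = m} as a<m = cong length (filter-reject (λ a → m ≤? toℕ a) {xs = as} (<⇒≱ a<m))

atLeast-↭ : ∀ m {as bs : List (Fin n)} → as ↭ bs → atLeast m as ≡ atLeast m bs
atLeast-↭ m as↭bs = ↭-length (filter-↭ (λ a → m ≤? toℕ a) as↭bs)

-- m ∈ U in terms of the list of preferences, with 0-based m and no subtraction.
Overfull : List (Fin n) → ℕ → Set
Overfull {n} as m = n < m + atLeast m as

-- The run consists of the k + 1 positions above `x`. Indexing it by the position below matches its
-- source, where `x` is the last free spot.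
LongRun : ℕ → List (Fin n) → Set
LongRun {n} k as = ∃[ x ] x + suc k < n × (∀ m → x < m → m ≤ x + suc k → Overfull as m)

-- From short intervals to parking

module _ (k : ℕ) (full : List (Fin n)) (noLongRun : ¬ LongRun k full) where

  -- All cars parked at or above m prefer spots at or above m.  The bound
  -- subtracts the cars still to come, so the cars already parked need no record.
  FreeSpotInvariant : Subset n → List (Fin n) → Set
  FreeSpotInvariant occ rest =
    ∀ f → f ∉ occ → ∀ m → toℕ f < m → m ≤ toℕ f + suc k →
    ∣ occ ∣≥ m + atLeast m rest ≤ atLeast m full

  -- A car preferring a spot from `m` on leaves the waiting cars, which pays for the one spot it may
  -- occupy there. Any other car has the free spot `f` within reach and so stops below `m`.
  invariant-step : ∀ {occ a rest s} → parkingSpot k occ a ≡ just s →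
                   FreeSpotInvariant occ (a ∷ rest) → FreeSpotInvariant (occ ∪ ⁅ s ⁆) rest
  invariant-step {occ} {a} {rest} {s} eq inv f f∉ m f<m m≤ with m ≤? toℕ a
  ... | yes m≤a = begin
    ∣ occ ∪ ⁅ s ⁆ ∣≥ m + atLeast m rest ≤⟨ +-monoˡ-≤ (atLeast m rest) (∣∪⁅ s ⁆∣≥-≤ m (parkingSpot-free k a eq)) ⟩
    suc (∣ occ ∣≥ m) + atLeast m rest   ≡⟨ +-suc (∣ occ ∣≥ m) _ ⟨
    ∣ occ ∣≥ m + suc (atLeast m rest)   ≡⟨ cong (∣ occ ∣≥ m +_) (atLeast-accept rest m≤a) ⟨
    ∣ occ ∣≥ m + atLeast m (a ∷ rest)   ≤⟨ inv f (f∉ ∘ x∈p∪q⁺ ∘ inj₁) m f<m m≤ ⟩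
    atLeast m full                      ∎
    where open ≤-Reasoning
  ... | no m≰a = begin
    ∣ occ ∪ ⁅ s ⁆ ∣≥ m + atLeast m rest ≡⟨ cong₂ _+_ (∣∪⁅ s ⁆∣≥-> m s<m) (sym (atLeast-reject rest a<m)) ⟩
    ∣ occ ∣≥ m + atLeast m (a ∷ rest)   ≤⟨ inv f f∉occ m f<m m≤ ⟩
    atLeast m full                      ∎
    where
    open ≤-Reasoning
    a<m = ≰⇒> m≰a
    f∉occ = f∉ ∘ x∈p∪q⁺ ∘ inj₁

    -- This is why the invariant only speaks of `m` up to f + k + 1: a car preferring a spot below
    -- `m` must be able to back up to `f`.
    a≤f+k : toℕ a ≤ toℕ f + k
    a≤f+k = s≤s⁻¹ (≤-trans a<m (≤-trans m≤ (≤-reflexive (+-suc (toℕ f) k))))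

    s<m : toℕ s < m
    s<m with parkingSpot-first k a eq f∉occ a≤f+k
    ... | inj₁ refl             = f<m
    ... | inj₂ (inj₁ (_ , s≤a)) = ≤-<-trans s≤a a<m
    ... | inj₂ (inj₂ (s<f , _)) = <-trans s<f f<m

  -- Induction on the waiting cars. The size bound leaves a free spot for each of them, so a failing
  -- car yields a last free spot, above which there is a long run.
  allPark : ∀ occ rest → ∣ occ ∣ + length rest ≤ n → FreeSpotInvariant occ rest → AllPark k occ rest
  allPark occ []         size inv = []
  allPark occ (a ∷ rest) size inv with parkingSpot k occ a in eq
  ... | just s  = eq ∷ allPark (occ ∪ ⁅ s ⁆) rest
                         (≤-trans (≤-reflexive (trans (cong (_+ length rest) (∣∪⁅ s ⁆∣ (parkingSpot-free k a eq)))
                                                      (sym (+-suc ∣ occ ∣ _)))) size)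
                         (invariant-step eq inv)
  ... | nothing with lastFree occ
  ...   | inj₁ all∈ = contradiction (full-∣∣≥ occ 0 (λ i _ → all∈ i))
                        (<⇒≱ (≤-trans (s≤s (m≤m+n ∣ occ ∣ _)) (≤-trans (≤-reflexive (sym (+-suc ∣ occ ∣ _))) size)))
  ...   | inj₂ (f , f∉ , all∈) = contradiction (toℕ f , ≤-<-trans f+1+k≤a (Fin.toℕ<n a) , run) noLongRun
    where
    open ≤-Reasoning
    -- The failing car would have taken `f` if `f` had been within its reach.
    f+1+k≤a : toℕ f + suc k ≤ toℕ a
    f+1+k≤a = ≤-trans (≤-reflexive (+-suc (toℕ f) k)) (≰⇒> (f∉ ∘ parkingSpot-nothing k a eq))

    -- All n - m spots from `m` on are occupied, and the invariant charges them to cars preferring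
    -- such spots. The failing car is one more of these, hence `suc n`.
    run : ∀ m → toℕ f < m → m ≤ toℕ f + suc k → Overfull full m
    run m f<m m≤ = begin
      suc n                                   ≤⟨ s≤s (full-∣∣≥ occ m (λ i m≤i → all∈ i (<-≤-trans f<m m≤i))) ⟩
      suc (m + ∣ occ ∣≥ m)                    ≡⟨ +-suc m _ ⟨
      m + suc (∣ occ ∣≥ m)                    ≤⟨ +-monoʳ-≤ m (s≤s (m≤m+n _ (atLeast m rest))) ⟩
      m + suc (∣ occ ∣≥ m + atLeast m rest)   ≡⟨ cong (m +_) (+-suc (∣ occ ∣≥ m) _) ⟨
      m + (∣ occ ∣≥ m + suc (atLeast m rest)) ≡⟨ cong (λ c → m + (∣ occ ∣≥ m + c)) (atLeast-accept rest (≤-trans m≤ f+1+k≤a)) ⟨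
      m + (∣ occ ∣≥ m + atLeast m (a ∷ rest)) ≤⟨ +-monoʳ-≤ m (inv f f∉ m f<m m≤) ⟩
      m + atLeast m full                      ∎

¬LongRun⇒AllPark : ∀ k {as : List (Fin n)} → length as ≡ n → ¬ LongRun k as → AllPark k ⊥ as
¬LongRun⇒AllPark {n} k {as} len noLongRun =
  allPark k as noLongRun ⊥ as (≤-reflexive (cong₂ _+_ (∣⊥∣≡0 n) len))
    (λ f f∉ m f<m m≤ → ≤-reflexive (cong (_+ atLeast m as) (∣⊥∣≥ n m)))

-- From parking to short intervals

module _ (k l : ℕ) (l≤n : l ≤ n) where

  -- The list holds only the cars still to come. If one of them prefers a spot below `m`, then in
  -- increasing order so did every car before it, and the count at `m` has not changed; the `Any`
  -- premise restricts the claim to these `m`.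
  Crowded : List (Fin n) → Set
  Crowded as = ∀ m → l < m → m ≤ l + k → Any (λ a → toℕ a < m) as → Overfull as m

  -- No car of `as` parks below `l`, so in the end they all fit into the n - l spots from `l` on.
  -- The premise allows one car too many, and the conclusion excludes it.
  increasing-crowd : ∀ occ as {bs} → AllPark k occ (as ++ bs) →
    AllPairs Fin._≤_ as → All (λ a → l ≤ toℕ a) as → (∀ {i} → i ∈ occ → l ≤ toℕ i) →
    l + (∣ occ ∣ + length as) ≤ suc n → Crowded as →
    l + (∣ occ ∣ + length as) ≤ n
  increasing-crowd occ [] _ _ _ l≤occ _ _ =
    ≤-trans (≤-reflexive (cong (l +_) (+-identityʳ ∣ occ ∣))) (∣∣-bounded occ l l≤n l≤occ)
  increasing-crowd occ (a ∷ as) (_∷_ {s = s} eq park) (a≤as ∷ as↗) (l≤a ∷ l≤as) l≤occ size crowded =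
    subst (λ c → l + c ≤ n) step
      (increasing-crowd (occ ∪ ⁅ s ⁆) as park as↗ l≤as l≤occ′
        (subst (λ c → l + c ≤ suc n) (sym step) size) crowded′)
    where
    s∉occ = parkingSpot-free k a eq

    step : ∣ occ ∪ ⁅ s ⁆ ∣ + length as ≡ ∣ occ ∣ + suc (length as)
    step = trans (cong (_+ length as) (∣∪⁅ s ⁆∣ s∉occ)) (sym (+-suc ∣ occ ∣ _))

    crowded′ : Crowded as
    crowded′ m l<m m≤ any =
      subst (λ c → n < m + c) (atLeast-reject as a<m) (crowded m l<m m≤ (there any))
      where
      a<m : toℕ a < m
      a<m with (b , b∈ , b<m) ← List.find any = ≤-<-trans (All.lookup a≤as b∈) b<m

    -- A car preferring a spot from l + k on cannot back up below `l`. Any other car would do so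
    -- only past a fully occupied [l, a], and too few cars have parked for that.
    l≤s : l ≤ toℕ s
    l≤s with l + k ≤? toℕ a
    ... | yes l+k≤a = +-cancelʳ-≤ k l (toℕ s) (≤-trans l+k≤a (parkingSpot-≥ k a eq))
    ... | no  l+k≰a with l ≤? toℕ s
    ...   | yes l≤s = l≤s
    ...   | no  l≰s = contradiction (interval-∣∣ occ l a occupied) (≤⇒≯ room)
      where
      open ≤-Reasoning
      a<l+k = ≰⇒> l+k≰a

      occupied : ∀ i → l ≤ toℕ i → i Fin.≤ a → i ∈ occ
      occupied i l≤i i≤a = decidable-stable (i ∈? occ) λ i∉occ →
        case-first (parkingSpot-first k a eq i∉occ
          (≤-trans (<⇒≤ a<l+k) (+-monoˡ-≤ k l≤i)))
        where
        case-first : ¬ (s ≡ i ⊎ Before a s i)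
        case-first (inj₁ refl)             = l≰s l≤i
        case-first (inj₂ (inj₁ (i<s , _))) = l≰s (≤-trans l≤i (<⇒≤ i<s))
        case-first (inj₂ (inj₂ (_ , a<i))) = <⇒≱ a<i i≤a

      -- Crowding at the threshold a + 1, with `a` itself as the car below it, bounds the number of
      -- later cars from below.
      enough : n ≤ toℕ a + length as
      enough = s≤s⁻¹ (begin
        suc n                                      ≤⟨ crowded (suc (toℕ a)) (s≤s l≤a) a<l+k (here ≤-refl) ⟩
        suc (toℕ a) + atLeast (suc (toℕ a)) (a ∷ as) ≡⟨ cong (suc (toℕ a) +_) (atLeast-reject as ≤-refl) ⟩
        suc (toℕ a) + atLeast (suc (toℕ a)) as     ≤⟨ +-monoʳ-≤ (suc (toℕ a)) (length-filter _ as) ⟩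
        suc (toℕ a) + length as                    ∎)

      -- With that many cars still to come, the size bound leaves at most a - l parked cars, fewer
      -- than the spots in [l, a].
      room : l + ∣ occ ∣ ≤ toℕ a
      room = +-cancelʳ-≤ (suc (length as)) _ _ (begin
        l + ∣ occ ∣ + suc (length as)   ≡⟨ +-assoc l ∣ occ ∣ _ ⟩
        l + (∣ occ ∣ + suc (length as)) ≤⟨ size ⟩
        suc n                           ≤⟨ s≤s enough ⟩
        suc (toℕ a + length as)         ≡⟨ +-suc (toℕ a) _ ⟨
        toℕ a + suc (length as)         ∎)

    l≤occ′ : ∀ {i} → i ∈ occ ∪ ⁅ s ⁆ → l ≤ toℕ i
    l≤occ′ i∈ with x∈p∪q⁻ occ ⁅ s ⁆ i∈
    ... | inj₁ i∈occ = l≤occ i∈occ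
    ... | inj₂ i∈s   rewrite x∈⁅y⁆⇒x≡y s i∈s = l≤s

-- Splitting the preferences at a threshold, and an order that fails

filter-complement-↭ : {P : Pred A 0ℓ} (P? : Decidable P) (xs : List A) →
                      filter P? xs ++ filter (¬? ∘ P?) xs ↭ xs
filter-complement-↭ P? [] = ↭-refl
filter-complement-↭ P? (x ∷ xs) with does (P? x)
... | true  = prep x (filter-complement-↭ P? xs)
... | false = ↭-trans (shift x (filter P? xs) _) (prep x (filter-complement-↭ P? xs))

filter-filter-⊆ : {P Q : Pred A 0ℓ} (P? : Decidable P) (Q? : Decidable Q) → Q ⊆ P →
                  ∀ xs → filter Q? (filter P? xs) ≡ filter Q? xs
filter-filter-⊆ P? Q? Q⊆P [] = refl
filter-filter-⊆ P? Q? Q⊆P (x ∷ xs) with P? x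
filter-filter-⊆ P? Q? Q⊆P (x ∷ xs) | yes _ with does (Q? x)
... | true  = cong (x ∷_) (filter-filter-⊆ P? Q? Q⊆P xs)
... | false = filter-filter-⊆ P? Q? Q⊆P xs
filter-filter-⊆ P? Q? Q⊆P (x ∷ xs) | no ¬p =
  trans (filter-filter-⊆ P? Q? Q⊆P xs) (sym (filter-reject Q? (¬p ∘ Q⊆P)))

atLeast-filter : ∀ {l m} (as : List (Fin n)) → l ≤ m →
                 atLeast m (filter (λ a → l ≤? toℕ a) as) ≡ atLeast m as
atLeast-filter {l = l} {m} as l≤m =
  cong length (filter-filter-⊆ (λ a → l ≤? toℕ a) (λ a → m ≤? toℕ a) (≤-trans l≤m) as)

atLeast-antitone : ∀ {l m} (as : List (Fin n)) → l ≤ m → atLeast m as ≤ atLeast l as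
atLeast-antitone {l = l} {m} as l≤m =
  ≤-trans (≤-reflexive (sym (atLeast-filter as l≤m)))
          (length-filter (λ a → m ≤? toℕ a) (filter (λ a → l ≤? toℕ a) as))

LongRun⇒¬AllPark : ∀ k {x} {as : List (Fin n)} → x + suc k < n → ¬ Overfull as x →
                   (∀ m → x < m → m ≤ x + suc k → Overfull as m) →
                   ∃[ bs ] bs ↭ as × ¬ AllPark k ⊥ bs
LongRun⇒¬AllPark {n} k {x} {as} x+1+k<n ¬overfull run = bs , bs↭as , ¬park
  where
  open ≤-Reasoning
  open Data.List.Sort (Fin.≤-decTotalOrder n) using (sort; sort-↭; sort-↗)

  l = suc x
  l≤? = λ (a : Fin n) → l ≤? toℕ a
  high = sort (filter l≤? as)
  bs = high ++ filter (¬? ∘ l≤?) as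

  bs↭as : bs ↭ as
  bs↭as = ↭-trans (++⁺ʳ _ (sort-↭ _)) (filter-complement-↭ l≤? as)

  length-high : length high ≡ atLeast l as
  length-high = ↭-length (sort-↭ (filter l≤? as))

  l≤n : l ≤ n
  l≤n = ≤-trans (s≤s (m≤m+n x _)) x+1+k<n

  size : l + (∣ ⊥ {n} ∣ + length high) ≤ suc n
  size = begin
    l + (∣ ⊥ {n} ∣ + length high) ≡⟨ cong₂ (λ c d → l + (c + d)) (∣⊥∣≡0 n) length-high ⟩
    suc (x + atLeast l as)        ≤⟨ s≤s (+-monoʳ-≤ x (atLeast-antitone as (n≤1+n x))) ⟩
    -- Non-overfullness just below the run limits the surplus from `l` on to one car.
    suc (x + atLeast x as)        ≤⟨ s≤s (≮⇒≥ ¬overfull) ⟩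
    suc n                         ∎

  crowded : Crowded k l l≤n high
  crowded m l<m m≤l+k _ = begin
    suc n              ≤⟨ run m (<-trans ≤-refl l<m) (≤-trans m≤l+k (≤-reflexive (sym (+-suc x k)))) ⟩
    m + atLeast m as   ≡⟨ cong (m +_) (atLeast-filter as (<⇒≤ l<m)) ⟨
    m + atLeast m (filter l≤? as) ≡⟨ cong (m +_) (atLeast-↭ m (sort-↭ (filter l≤? as))) ⟨
    m + atLeast m high ∎

  ¬park : ¬ AllPark k ⊥ bs
  -- Overfullness at `l`, the first position of the run, contradicts the bound obtained from
  -- parking.
  ¬park park = <⇒≱ (run l ≤-refl (≤-trans (s≤s (m≤m+n x k)) (≤-reflexive (sym (+-suc x k))))) (begin
    l + atLeast l as              ≡⟨ cong₂ (λ c d → l + (c + d)) (∣⊥∣≡0 n) length-high ⟨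
    l + (∣ ⊥ {n} ∣ + length high) ≤⟨ increasing-crowd k l l≤n ⊥ high park
                                       (Linked⇒AllPairs ≤-trans (sort-↗ _))
                                       (All-resp-↭ (↭-sym (sort-↭ _)) (All.all-filter l≤? as))
                                       (λ i∈ → contradiction i∈ ∉⊥) size crowded ⟩
    n                             ∎)

-- Permutations of Fin n and permutations of lists

-- Lists under `_++_` form a commutative monoid up to `_↭_`, and a tuple is the sum of its
-- singletons there; sums are invariant under reindexing.
toList-permute-↭ : ∀ (σ : Permutation′ n) (α : PP n) → toList (permute σ α) ↭ toList α
toList-permute-↭ {n} σ α =
  ↭-trans (↭-reflexive (sym (sum-[-] (permute σ α))))
    (↭-trans (↭-sym (sum-permute ([_] ∘ α) σ)) (↭-reflexive (sum-[-] α)))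
  where
  open MonoidSum (++-commutativeMonoid {A = Fin n}) using (sum-permute) renaming (sum to concat)

  sum-[-] : ∀ {m} (β : Fin m → Fin n) → concat ([_] ∘ β) ≡ tabulate β
  sum-[-] {zero}  β = refl
  sum-[-] {suc m} β = cong (β zero ∷_) (sum-[-] (β ∘ suc))

↭⇒permute : (α : PP n) {bs : List (Fin n)} → bs ↭ toList α → ∃[ σ ] toList (permute {n} σ α) ≡ bs
↭⇒permute {n} α {bs} bs↭ = helper α bs (trans (↭-length bs↭) (length-tabulate α)) bs↭
  where
  -- Separating the length of the tuple from the type of its entries allows the length equation to
  -- be matched with `refl`.
  helper : ∀ {n} {A : Set} (α : Fin n → A) (bs : List A) → length bs ≡ n → bs ↭ tabulate α →
           ∃[ σ ] tabulate (α ∘ (_⟨$⟩ʳ_ {n} {n} σ)) ≡ bs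
  helper {A = A} α bs refl bs↭ = τ ∘ₚ cast-id len , trans (tabulate-cong pointwise) (tabulate-lookup bs)
    where
    len = length-tabulate α
    τ = onIndices (↭⇒↭ₛ bs↭)
    pointwise : ∀ i → α (cast len (τ ⟨$⟩ʳ i)) ≡ lookup bs i
    pointwise i = begin
      α (cast len (τ ⟨$⟩ʳ i)) ≡⟨ lookup-tabulate α _ ⟨
      lookup (tabulate α) (cast (sym len) (cast len (τ ⟨$⟩ʳ i)))
        ≡⟨ cong (lookup (tabulate α)) (Fin.cast-involutive (sym len) len _) ⟩
      lookup (tabulate α) (τ ⟨$⟩ʳ i) ≡⟨ onIndices-lookup (setoid A) (↭⇒↭ₛ bs↭) i ⟨
      lookup bs i ∎
      where open ≡-Reasoning

-- The excess function

length-filter-map : {P : Pred B 0ℓ} (P? : Decidable P) (f : A → B) (xs : List A) →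
                    length (filter P? (map f xs)) ≡ length (filter (P? ∘ f) xs)
length-filter-map P? f [] = refl
length-filter-map P? f (x ∷ xs) with does (P? (f x))
... | true  = cong suc (length-filter-map P? f xs)
... | false = length-filter-map P? f xs

-- By uniqueness exactly one summand grows; a repeated `x` would raise the sum several times.
sum-map-suc-at : {g g′ : A → ℕ} {x : A} {is : List A} → Unique is → x List.∈ is →
                 g′ x ≡ suc (g x) → (∀ {i} → i ≢ x → g′ i ≡ g i) →
                 sum (map g′ is) ≡ suc (sum (map g is))
sum-map-suc-at (x∉ ∷ _) (here refl) at other =
  cong₂ _+_ at (cong sum (map-cong-local (All.map (λ x≢i → other (x≢i ∘ sym)) x∉)))
sum-map-suc-at {g = g} (i∉ ∷ unique) (there x∈) at other =
  trans (cong₂ _+_ (other (All.lookup i∉ x∈)) (sum-map-suc-at unique x∈ at other)) (+-suc _ _)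

-- Double counting: an `h` with `P (f h)` lies in exactly one of the fibres summed over, any other
-- `h` in none.
sum-fibres : {P : Pred (Fin n) 0ℓ} (P? : Decidable P) (f : A → Fin n) (hs : List A) →
             {is : List (Fin n)} → Unique is → (∀ {i} → P i ⇔ i List.∈ is) →
             sum (map (λ i → length (filter (λ h → f h Fin.≟ i) hs)) is) ≡ length (filter (P? ∘ f) hs)
sum-fibres P? f [] {is} unique P⇔∈ = sum-zero is
  where
  sum-zero : (is : List (Fin n)) → sum (map (λ _ → 0) is) ≡ 0
  sum-zero []       = refl
  sum-zero (_ ∷ is) = sum-zero is
sum-fibres P? f (h ∷ hs) {is} unique P⇔∈ with P? (f h)
... | yes p = trans (sum-map-suc-at unique (Equivalence.to P⇔∈ p)
                       (cong length (filter-accept (λ h → f h Fin.≟ _) {xs = hs} refl))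
                       (λ i≢ → cong length (filter-reject (λ h → f h Fin.≟ _) {xs = hs} (i≢ ∘ sym))))
                    (cong suc (sum-fibres P? f hs unique P⇔∈))
... | no ¬p = trans (cong sum (map-cong-local (All.tabulate λ {i} i∈ →
                       cong length (filter-reject (λ h → f h Fin.≟ i) {xs = hs}
                         λ fh≡i → ¬p (Equivalence.from P⇔∈ (subst (List._∈ is) (sym fh≡i) i∈))))))
                    (sum-fibres P? f hs unique P⇔∈)

sum-multiplicity : ∀ (α : PP n) (j : Fin n) →
  sum (map (multiplicity α) (filter (j Fin.≤?_) (allFin n))) ≡ atLeast (toℕ j) (toList α)
sum-multiplicity {n} α j = begin
  sum (map (multiplicity α) (filter (j Fin.≤?_) (allFin n)))
    ≡⟨ sum-fibres (j Fin.≤?_) α (allFin n) (Unique.filter⁺ (j Fin.≤?_) (Unique.allFin⁺ n))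
         (mk⇔ (∈-filter⁺ (j Fin.≤?_) (∈-allFin _)) (proj₂ ∘ ∈-filter⁻ (j Fin.≤?_) {xs = allFin n})) ⟩
  length (filter (λ h → j Fin.≤? α h) (allFin n)) ≡⟨ length-filter-map (j Fin.≤?_) α (allFin n) ⟨
  atLeast (toℕ j) (map α (allFin n))              ≡⟨ cong (atLeast (toℕ j)) (map-tabulate id α) ⟩
  atLeast (toℕ j) (toList α)                      ∎
  where open ≡-Reasoning

-- Adding `n` clears the subtractions, so that an integer inequality becomes one between naturals.
-- The 1 in the spot number cancels the 1 in the definition.
excess+n : ∀ {n} (α : PP n) (j : Fin n) → excess α j ℤ.+ ℤ.+ n ≡ ℤ.+ (toℕ j + atLeast (toℕ j) (toList α))
excess+n {n} α j =
  trans (regroup (ℤ.+ _) (ℤ.+ n) (ℤ.+ toℕ j)) (cong (λ c → ℤ.+ (toℕ j + c)) (sum-multiplicity α j))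
  where
  regroup : ∀ g n j → g ℤ.- (n ℤ.- (1ℤ ℤ.+ j) ℤ.+ 1ℤ) ℤ.+ n ≡ j ℤ.+ g
  regroup = ℤ.solve-∀

U⇔Overfull : ∀ (α : PP n) (j : Fin n) → U α j ⇔ Overfull (toList α) (toℕ j)
U⇔Overfull {n} α j = mk⇔
  (λ u → ℤ.drop‿+≤+ (subst (ℤ.+ suc n ℤ.≤_) (excess+n α j) (ℤ.+-monoˡ-≤ (ℤ.+ n) u)))
  (λ o → subst₂ ℤ._≤_ (cancel 1ℤ (ℤ.+ n)) (cancel (excess α j) (ℤ.+ n))
           (ℤ.+-monoˡ-≤ (ℤ.- ℤ.+ n) (subst (ℤ.+ suc n ℤ.≤_) (sym (excess+n α j)) (ℤ.+≤+ o))))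
  where
  cancel : ∀ i n → i ℤ.+ n ℤ.- n ≡ i
  cancel = ℤ.solve-∀

-- Maximal intervals

module _ {S : Pred (Fin n) 0ℓ} {p q : Fin n} where

  -- An interval reaching beyond [p, q] contains the neighbour of `p` or of `q`, so testing these
  -- suffices. Naming the neighbours by equations covers the ends of the street, where there is
  -- none.
  maximalInterval : p Fin.≤ q → ⟦ p , q ⟧ ⊆ S →
                    (∀ i → suc (toℕ i) ≡ toℕ p → ¬ S i) →
                    (∀ i → toℕ i ≡ suc (toℕ q) → ¬ S i) →
                    IsMaximalInterval S p q
  maximalInterval p≤q pq⊆S ¬below ¬above = record
    { nonempty  = p≤q
    ; contained = pq⊆S
    ; maximal   = λ p′ q′ ⊆S pq⊆ {i} (p′≤i , i≤q′) →
        ≮⇒≥ (λ i<p → below p′ q′ ⊆S pq⊆ p′≤i i<p) , ≮⇒≥ (λ q<i → above p′ q′ ⊆S pq⊆ i≤q′ q<i)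
    }
    where
    module _ p′ q′ (⊆S : ⟦ p′ , q′ ⟧ ⊆ S) (pq⊆ : ⟦ p , q ⟧ ⊆ ⟦ p′ , q′ ⟧) {i : Fin n} where

      below : p′ Fin.≤ i → ¬ i Fin.< p
      below p′≤i i<p = ¬below j sj≡p (⊆S (≤-trans p′≤i i≤j , ≤-trans j≤p (proj₂ (pq⊆ (≤-refl , p≤q)))))
        where
        predecessor : ∀ {i p : Fin n} → i Fin.< p → ∃[ j ] suc (toℕ j) ≡ toℕ p
        predecessor {p = suc p} _ = Fin.inject₁ p , cong suc (Fin.toℕ-inject₁ p)

        j = proj₁ (predecessor i<p)
        sj≡p = proj₂ (predecessor i<p)

        i≤j : i Fin.≤ j
        i≤j = s≤s⁻¹ (subst (toℕ i <_) (sym sj≡p) i<p)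

        j≤p : j Fin.≤ p
        j≤p = subst (toℕ j ≤_) sj≡p (n≤1+n _)

      above : i Fin.≤ q′ → ¬ q Fin.< i
      above i≤q′ q<i = ¬above j j≡sq (⊆S
        ( ≤-trans (proj₁ (pq⊆ (p≤q , ≤-refl))) (subst (toℕ q ≤_) (sym j≡sq) (n≤1+n _))
        , ≤-trans (subst (_≤ toℕ i) (sym j≡sq) q<i) i≤q′))
        where
        sq<n = ≤-<-trans q<i (Fin.toℕ<n i)
        j = fromℕ< sq<n
        j≡sq = Fin.toℕ-fromℕ< sq<n

  maximalInterval-¬below : IsMaximalInterval S p q → ∀ {i} → suc (toℕ i) ≡ toℕ p → ¬ S i
  maximalInterval-¬below max {i} si≡p Si =
    <⇒≱ (≤-reflexive si≡p) (proj₁ (maximal i q iq⊆S (λ (p≤j , j≤q) → ≤-trans i≤p p≤j , j≤q) (≤-refl , ≤-trans i≤p nonempty)))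
    where
    open IsMaximalInterval max

    i≤p : i Fin.≤ p
    i≤p = subst (toℕ i ≤_) si≡p (n≤1+n _)

    iq⊆S : ⟦ i , q ⟧ ⊆ S
    iq⊆S {j} (i≤j , j≤q) with m≤n⇒m<n∨m≡n i≤j
    ... | inj₁ i<j = contained (subst (_≤ toℕ j) si≡p i<j , j≤q)
    ... | inj₂ i≡j = subst S (Fin.toℕ-injective i≡j) Si

-- Long runs and long maximal intervals

module _ {P : Pred ℕ 0ℓ} (P? : Decidable P) where

  extend-down : ∀ x → ¬ P 0 → P x → ∃[ l ] l < x × ¬ P l × (∀ m → l < m → m ≤ x → P m)
  extend-down zero    ¬P0 Px = contradiction Px ¬P0
  extend-down (suc x) ¬P0 Psx with P? x
  ... | no ¬Px = x , ≤-refl , ¬Px , λ m x<m m≤sx → subst P (≤-antisym x<m m≤sx) Psx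
  ... | yes Px with (l , l<x , ¬Pl , run) ← extend-down x ¬P0 Px =
    l , m≤n⇒m≤1+n l<x , ¬Pl , λ m l<m m≤sx → longer m l<m (m≤n⇒m<n∨m≡n m≤sx)
    where
    longer : ∀ m → l < m → m < suc x ⊎ m ≡ suc x → P m
    longer m l<m (inj₁ m<sx) = run m l<m (s≤s⁻¹ m<sx)
    longer m l<m (inj₂ refl) = Psx

  -- The distance `d` to a position known to fail `P` makes the upward search structurally
  -- recursive.
  extend-up : ∀ d y → P y → ¬ P (d + y) →
              ∃[ r ] y ≤ r × r < d + y × ¬ P (suc r) × (∀ m → y ≤ m → m ≤ r → P m)
  extend-up zero    y Py ¬P = contradiction Py ¬P
  extend-up (suc d) y Py ¬P with P? (suc y)
  ... | no ¬Psy = y , ≤-refl , s≤s (m≤n+m y d) , ¬Psy , λ m y≤m m≤y → subst P (≤-antisym y≤m m≤y) Py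
  ... | yes Psy with (r , y<r , r< , ¬Psr , run) ← extend-up d (suc y) Psy (subst (¬_ ∘ P) (sym (+-suc d y)) ¬P) =
    r , <⇒≤ y<r , subst (r <_) (+-suc d y) r< , ¬Psr , λ m y≤m m≤r → longer m m≤r (m≤n⇒m<n∨m≡n y≤m)
    where
    longer : ∀ m → m ≤ r → y < m ⊎ y ≡ m → P m
    longer m m≤r (inj₁ y<m)  = run m y<m m≤r
    longer m m≤r (inj₂ refl) = Py

Overfull? : (as : List (Fin n)) → Decidable (Overfull as)
Overfull? {n} as m = n <? m + atLeast m as

-- Together with `¬Overfull-n` this stops the extension of a run in both directions.
¬Overfull-0 : (as : List (Fin n)) → length as ≡ n → ¬ Overfull as 0
¬Overfull-0 as len = ≤⇒≯ (≤-trans (length-filter _ as) (≤-reflexive len))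

¬Overfull-n : (as : List (Fin n)) → ¬ Overfull as n
¬Overfull-n {n} as = ≤⇒≯ (≤-reflexive
  (trans (cong (λ bs → n + length bs) (filter-none (λ a → n ≤? toℕ a) (All.universal (<⇒≱ ∘ Fin.toℕ<n) as)))
         (+-identityʳ n)))

maximalRun⇒long-interval : ∀ (α : PP n) {k l r} → l + k < r → r < n →
  ¬ Overfull (toList α) l → ¬ Overfull (toList α) (suc r) →
  (∀ m → l < m → m ≤ r → Overfull (toList α) m) →
  ∃[ p ] ∃[ q ] IsMaximalInterval (U α) p q × k < intervalSize p q
maximalRun⇒long-interval {n} α {k} {l} {r} l+k<r r<n ¬l ¬1+r run = p , q , max , size
  where
  l<r = ≤-<-trans (m≤m+n l k) l+k<r
  1+l<n = ≤-<-trans l<r r<n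
  p = fromℕ< 1+l<n
  q = fromℕ< r<n
  p≡ = Fin.toℕ-fromℕ< 1+l<n
  q≡ = Fin.toℕ-fromℕ< r<n

  U⇒Overfull : ∀ {j m} → toℕ j ≡ m → U α j → Overfull (toList α) m
  U⇒Overfull {j} refl = Equivalence.to (U⇔Overfull α j)

  max : IsMaximalInterval (U α) p q
  max = maximalInterval (subst₂ _≤_ (sym p≡) (sym q≡) l<r)
    (λ {i} (p≤i , i≤q) → Equivalence.from (U⇔Overfull α i)
      (run (toℕ i) (subst (_≤ toℕ i) p≡ p≤i) (subst (toℕ i ≤_) q≡ i≤q)))
    (λ i 1+i≡p → ¬l ∘ U⇒Overfull (suc-injective (trans 1+i≡p p≡)))
    (λ i i≡1+q → ¬1+r ∘ U⇒Overfull (trans i≡1+q (cong suc q≡)))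

  size : k < intervalSize p q
  size = begin-strict
    k                ≤⟨ m+n≤o⇒m≤o∸n k (subst (_≤ r) (trans (cong suc (+-comm l k)) (sym (+-suc k l))) l+k<r) ⟩
    r ∸ suc l        <⟨ m<m+n _ (s≤s z≤n) ⟩
    r ∸ suc l + 1    ≡⟨ cong₂ (λ r l → r ∸ l + 1) q≡ p≡ ⟨
    intervalSize p q ∎
    where open ≤-Reasoning

LongRun⇒long-interval : ∀ (α : PP n) k → LongRun k (toList α) →
  ∃[ p ] ∃[ q ] IsMaximalInterval (U α) p q × k < intervalSize p q
LongRun⇒long-interval {n} α k (x , y<n , run)
  with (l , l<1+x , ¬l , down) ← extend-down (Overfull? (toList α)) (suc x)
         (¬Overfull-0 (toList α) (length-tabulate α)) (run (suc x) ≤-refl (m<m+n x (s≤s z≤n)))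
     | (r , y≤r , r< , ¬1+r , up) ← extend-up (Overfull? (toList α)) (n ∸ (x + suc k)) (x + suc k)
         (run (x + suc k) (m<m+n x (s≤s z≤n)) ≤-refl)
         (subst (¬_ ∘ Overfull (toList α)) (sym (m∸n+n≡m (<⇒≤ y<n))) (¬Overfull-n (toList α)))
  = maximalRun⇒long-interval α
      (≤-trans (≤-reflexive (sym (+-suc l k))) (≤-trans (+-monoˡ-≤ (suc k) (s≤s⁻¹ l<1+x)) y≤r))
      (subst (r <_) (m∸n+n≡m (<⇒≤ y<n)) r<) ¬l ¬1+r joined
  where
  -- Three overlapping stretches: the downward extension, the given run and the upward extension.
  joined : ∀ m → l < m → m ≤ r → Overfull (toList α) m
  joined m l<m m≤r with m ≤? x | m ≤? x + suc k
  ... | yes m≤x | _         = down m l<m (m≤n⇒m≤1+n m≤x)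
  ... | no  m≰x | yes m≤y   = run m (≰⇒> m≰x) m≤y
  ... | no  _   | no  m≰y   = up m (<⇒≤ (≰⇒> m≰y)) m≤r

-- Position 0 is never overfull, so the interval has a position `x` just below it. Maximality makes
-- `x` not overfull, and the k + 1 positions above `x` lie in the interval.
long-interval⇒run : ∀ (α : PP n) {k p q} → IsMaximalInterval (U α) p q → k < intervalSize p q →
  ∃[ x ] x + suc k < n × ¬ Overfull (toList α) x ×
         (∀ m → x < m → m ≤ x + suc k → Overfull (toList α) m)
long-interval⇒run α {p = zero} max _ =
  contradiction (Equivalence.to (U⇔Overfull α zero) (contained (≤-refl , nonempty)))
                (¬Overfull-0 (toList α) (length-tabulate α))
  where open IsMaximalInterval max
long-interval⇒run {n} α {k} {suc p} {q} max k<size =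
  toℕ p , y<n , ¬overfull , λ m p<m m≤y →
    let m<n = ≤-<-trans m≤y y<n
        m≡  = Fin.toℕ-fromℕ< m<n
    in subst (Overfull (toList α)) m≡ (Equivalence.to (U⇔Overfull α (fromℕ< m<n))
         (contained (subst (toℕ p <_) (sym m≡) p<m , subst (_≤ toℕ q) (sym m≡) (≤-trans m≤y y≤q))))
  where
  open IsMaximalInterval max
  open ≤-Reasoning

  y≤q : toℕ p + suc k ≤ toℕ q
  y≤q = begin
    toℕ p + suc k                       ≡⟨ +-suc (toℕ p) k ⟩
    suc (toℕ p) + k                     ≤⟨ +-monoʳ-≤ (suc (toℕ p)) (s≤s⁻¹ (subst (k <_) (+-comm _ 1) k<size)) ⟩
    suc (toℕ p) + (toℕ q ∸ suc (toℕ p)) ≡⟨ m+[n∸m]≡n nonempty ⟩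
    toℕ q                               ∎

  y<n = ≤-<-trans y≤q (Fin.toℕ<n q)

  ¬overfull : ¬ Overfull (toList α) (toℕ p)
  ¬overfull o = maximalInterval-¬below max (cong suc p≡)
    (Equivalence.from (U⇔Overfull α (Fin.inject₁ p)) (subst (Overfull (toList α)) (sym p≡) o))
    where p≡ = Fin.toℕ-inject₁ p

corollary4p2 : (n : ℕ) (α : PP n) (k : ℕ) → 1 ≤ k →
    ((p q : Fin n) → IsMaximalInterval (U α) p q → intervalSize p q ≤ k)
    ⇔ ((σ : Permutation′ n) → PF n k (permute σ α))
corollary4p2 n α k _ = mk⇔ short⇒park park⇒short
  where
  short⇒park : ((p q : Fin n) → IsMaximalInterval (U α) p q → intervalSize p q ≤ k) →
               (σ : Permutation′ n) → PF n k (permute σ α)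
  short⇒park short σ = ¬LongRun⇒AllPark k (length-tabulate (permute σ α)) λ (x , y<n , run) →
    let (p , q , max , k<size) = LongRun⇒long-interval α k
          -- Overfullness ignores the order of the cars, so a run for the permuted tuple is one for
          -- `α`.
          (x , y<n , λ m x<m m≤y → subst (λ c → n < m + c) (atLeast-↭ m (toList-permute-↭ σ α)) (run m x<m m≤y))
    in <⇒≱ k<size (short p q max)

  park⇒short : ((σ : Permutation′ n) → PF n k (permute σ α)) →
               (p q : Fin n) → IsMaximalInterval (U α) p q → intervalSize p q ≤ k
  park⇒short park p q max = ≮⇒≥ λ k<size →
    let (x , y<n , ¬x , run) = long-interval⇒run α max k<size
        (bs , bs↭ , ¬bs)     = LongRun⇒¬AllPark k y<n ¬x run
        (σ , σα≡)            = ↭⇒permute α bs↭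
    in ¬bs (subst (AllPark k ⊥) σα≡ (park σ))
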